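{- Let $\mathit{Exp}$ be the set of conditional expressions over a set $A$ of symbols, and let $\prec_2$ be the recursion relation on $\mathit{Exp}$ of the nested-recursive normalization function $norm_2$, as defined in the context. Then $\prec_2$ is well-founded; that is, for every predicate $P$ on $\mathit{Exp}$, $$\Bigl(\forall x.\,\bigl(\forall x'.\,x'\prec_2 x\Rightarrow P(x')\bigr)\Rightarrow P(x)\Bigr)\;\Longrightarrow\;\forall x.\,P(x),$$ where $x,x'$ range over $\mathit{Exp}$.
   Context: Fix a set $A$ of symbols. The set $\mathit{Exp}$ of conditional expressions is the inductive type freely generated by the constructors $At(a)$ for $a\in A$ and $\mathit{If}(x,y,z)$ for $x,y,z\in\mathit{Exp}$. The predicate $ISN$ ("is in normal form") on $\mathit{Exp}$ is defined recursively by $$ISN(At(a))\iff\textit{true},\qquad ISN(\mathit{If}(At(a),y,z))\iff ISN(y)\wedge ISN(z),$$ $$ISN(\mathit{If}(\mathit{If}(u,v,w),y,z))\iff\textit{false}.$$ The function $norm_2$ is given by the recursion equations $$norm_2(At(a))=At(a),\qquad norm_2(\mathit{If}(At(a),y,z))=\mathit{If}(At(a),norm_2(y),norm_2(z)),$$ $$norm_2(\mathit{If}(\mathit{If}(u,v,w),y,z))=norm_2\bigl(\mathit{If}(u,\,norm_2(\mathit{If}(v,y,z)),\,norm_2(\mathit{If}(w,y,z)))\bigr).$$ Its recursion relation $\prec_2$ on $\mathit{Exp}$, in which the results of inner calls are represented by arbitrary normal expressions, is defined by cases on the right-hand argument: $$x\prec_2 At(a)\iff\textit{false},$$ $$x\prec_2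 \mathit{If}(At(a),y,z)\iff x=y\lor x=z,$$ $$x\prec_2 \mathit{If}(\mathit{If}(u,v,w),y,z)\iff x=\mathit{If}(v,y,z)\;\lor\;x=\mathit{If}(w,y,z)\;\lor\;\exists v'\,w'.\,ISN(v')\wedge ISN(w')\wedge x=\mathit{If}(u,v',w').$$ A relation is called well-founded if its rule of well-founded induction is sound for every predicate $P$. -}

module Defs where

open import Level using (Level)
open import Data.Empty using (⊥)
open import Data.Empty.Polymorphic using () renaming (⊥ to ⊥ₚ)
open import Data.Unit using (⊤)
open import Data.Product using (_×_; ∃₂)
open import Data.Sum using (_⊎_)
open import Relation.Binary.PropositionalEquality using (_≡_)

data Exp {a : Level} (A : Set a) : Set a where
  At : A → Exp A
  If : Exp A → Exp A → Exp A → Exp A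

module _ {a : Level} {A : Set a} where

  ISN : Exp A → Set
  ISN (At s)                = ⊤
  ISN (If (At s) y z)       = ISN y × ISN z
  ISN (If (If u v w) y z)   = ⊥

  infix 4 _≺₂_

  -- Recursion relation of the normalization function given by
  --   norm₂ (At s)              = At s
  --   norm₂ (If (At s) y z)     = If (At s) (norm₂ y) (norm₂ z)
  --   norm₂ (If (If u v w) y z) =
  --     norm₂ (If u (norm₂ (If v y z)) (norm₂ (If w y z)))
  -- where the results of the two inner calls in the last equation are
  -- represented by arbitrary normal expressions v′ and w′.
  _≺₂_ : Exp A → Exp A → Set a
  x ≺₂ At s              = ⊥ₚ
  x ≺₂ If (At s) y z     = x ≡ y ⊎ x ≡ z
  x ≺₂ If (If u v w) y z =
    x ≡ If v y z ⊎ x ≡ If w y z ⊎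
    ∃₂ λ v′ w′ → ISN v′ × ISN w′ × x ≡ If u v′ w′

{-# OPTIONS --safe #-}

-- Every If x y z with y and z accessible is accessible, by induction on the
-- test x alone.  When x = If u v w, the three kinds of predecessor have the
-- tests v, w and u; in the last kind the branches are arbitrary normal
-- expressions, which are accessible by structural induction because ≺₂ only
-- leads from a normal expression to its branches.
module Submission where

open import Level using (Level)
open import Data.Product using (_,_)
open import Data.Sum using (inj₁; inj₂)
open import Induction.WellFounded using (Acc; acc; WellFounded; module All)
open import Relation.Binary.PropositionalEquality using (refl)
open import Defs

module _ {a : Level} {A : Set a} where

  At-accessible : (s : A) → Acc _≺₂_ (At s)
  At-accessible s = acc λ ()

  If-At-accessible : ∀ s {y z : Exp A} → Acc _≺₂_ y → Acc _≺₂_ z →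
                     Acc _≺₂_ (If (At s) y z)
  If-At-accessible s ay az = acc λ where
    (inj₁ refl) → ay
    (inj₂ refl) → az

  ISN⇒accessible : (x : Exp A) → ISN x → Acc _≺₂_ x
  ISN⇒accessible (At s)           _         = At-accessible s
  -- A compound test makes `ISN` empty, so only atomic tests remain.
  ISN⇒accessible (If (At s) y z) (ny , nz) =
    If-At-accessible s (ISN⇒accessible y ny) (ISN⇒accessible z nz)

  -- The branches stay universally quantified in the induction, since the recursive call at `u`
  -- replaces them by `v′` and `w′`.
  If-accessible : ∀ x {y z : Exp A} → Acc _≺₂_ y → Acc _≺₂_ z →
                  Acc _≺₂_ (If x y z)
  If-accessible (At s)     ay az = If-At-accessible s ay az
  If-accessible (If u v w) ay az = acc λ where
    (inj₁ refl)        → If-accessible v ay az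
    (inj₂ (inj₁ refl)) → If-accessible w ay az
    (inj₂ (inj₂ (v′ , w′ , nv′ , nw′ , refl))) →
      If-accessible u (ISN⇒accessible v′ nv′) (ISN⇒accessible w′ nw′)

  -- Structural induction on the expression provides the accessible branches that `If-accessible`
  -- assumes.
  ≺₂-wellFounded : WellFounded (_≺₂_ {A = A})
  ≺₂-wellFounded (At s)     = At-accessible s
  ≺₂-wellFounded (If x y z) =
    If-accessible x (≺₂-wellFounded y) (≺₂-wellFounded z)

mainTheorem5 : {a ℓ : Level} (A : Set a) (P : Exp A → Set ℓ) →
    (∀ x → (∀ x′ → x′ ≺₂ x → P x′) → P x) →
    ∀ x → P x
mainTheorem5 {ℓ = ℓ} A P step =
  -- `rec` takes the predecessor implicitly, `step` explicitly.
  All.wfRec ≺₂-wellFounded ℓ P λ x rec → step x λ x′ → rec {x′}
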